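{- Let $\epsilon>0$ and let $n$ be a positive integer. If $G$ is a graph with $N\ge 128\epsilon^{ -3}n$ vertices and $\epsilon N^2$ edges, then $G$ contains (as a subgraph) every bipartite graph $H=(U_1,U_2;F)$ with parts $U_1,U_2$ and $n$ vertices in which every vertex of $U_2$ has degree $2$. -}

module Defs where

open import Data.Nat using (ℕ; zero; suc; _+_; _<ᵇ_)
open import Data.Bool using (Bool; true; false; if_then_else_; _∧_)
open import Data.Fin using (Fin; zero; suc; toℕ)
open import Data.Product using (Σ; _×_)
open import Data.Sum using (_⊎_; inj₁; inj₂)
open import Data.Integer using (+_)
open import Data.Rational using (ℚ; _/_)
open import Function.Definitions using (Injective)
open import Relation.Binary.PropositionalEquality using (_≡_)

sumFin : (k : ℕ) → (Fin k → ℕ) → ℕ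
sumFin zero    f = 0
sumFin (suc k) f = f zero + sumFin k (λ i → f (suc i))

countTrue : (k : ℕ) → (Fin k → Bool) → ℕ
countTrue k p = sumFin k (λ i → if p i then 1 else 0)

ℕ→ℚ : ℕ → ℚ
ℕ→ℚ n = (+ n) / 1

record Graph (N : ℕ) : Set where
  field
    adj    : Fin N → Fin N → Bool
    sym    : ∀ i j → adj i j ≡ adj j i
    irrefl : ∀ i → adj i i ≡ false
open Graph public

edgeCount : {N : ℕ} → Graph N → ℕ
edgeCount {N} G = sumFin N (λ i → countTrue N (λ j → (toℕ i <ᵇ toℕ j) ∧ adj G i j))

-- a bipartite graph H = (U₁, U₂; F) with U₁ = Fin a, U₂ = Fin b,
-- given by its edge relation F between the two parts
BipGraph : ℕ → ℕ → Set
BipGraph a b = Fin a → Fin b → Bool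

degree₂ : {a b : ℕ} → BipGraph a b → Fin b → ℕ
degree₂ {a} F j = countTrue a (λ i → F i j)

ContainsBip : {N a b : ℕ} → Graph N → BipGraph a b → Set
ContainsBip {N} {a} {b} G F =
  Σ (Fin a ⊎ Fin b → Fin N) λ φ →
    Injective _≡_ _≡_ φ × (∀ i j → F i j ≡ true → adj G (φ (inj₁ i)) (φ (inj₂ j)) ≡ true)

{-# OPTIONS --safe #-}
-- Dependent random choice with nested sets. View H as a multigraph on U₁ whose edges are the vertices
-- of U₂, and call a pair of vertices of G bad if it has fewer than n common neighbours. Starting from
-- the vertices of degree at least εN, intersect repeatedly with the neighbourhood of a random vertex
-- and discard the vertices of large bad degree. One step costs at most a factor 4/ε in size but makes
-- bad pairs g ≥ 4/ε times rarer, so after s steps bad degrees are at most a g⁻ˢ fraction of the set.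
-- Placing U₁ greedily, innermost sets first, with the vertices of degree about gˢ in the s-th set
-- (there are O(n g⁻ˢ) of them) never leaves a bad edge. Then U₂ is placed greedily, as every edge has
-- n common neighbours.
module Submission where

module Embedding where

  open import Defs renaming (sym to adj-sym)
  open import Data.Nat
  open import Data.Nat.Properties
  open import Data.Nat.DivMod using (m≡m%n+[m/n]*n; m%n<n; m/n*n≤m)
  open import Data.Nat.Tactic.RingSolver using (solve-∀)
  open import Data.Bool using (Bool; true; false; if_then_else_; _∧_)
  open import Data.Bool.Properties using (T-≡; ∧-comm; not-¬)
  open import Data.Fin using (Fin; zero; suc; toℕ)
  import Data.Fin.Properties as Fin
  open import Data.List using (List; []; _∷_; allFin)
  open import Data.List.Membership.Propositional using (_∈_)
  open import Data.List.Membership.Propositional.Properties using (∈-allFin)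
  open import Data.List.Relation.Unary.Any using (here; there)
  open import Data.Product using (Σ; ∃; _×_; _,_; proj₁; proj₂)
  open import Data.Sum using (_⊎_; inj₁; inj₂; [_,_]′)
  open import Data.Empty using (⊥; ⊥-elim)
  open import Function.Bundles using (module Equivalence)
  open import Relation.Nullary using (yes; no; does)
  open import Relation.Binary.PropositionalEquality

  -- Finite sums and averaging.

  𝟙 : Bool → ℕ
  𝟙 b = if b then 1 else 0

  sumFin-mono : ∀ k {f g : Fin k → ℕ} → (∀ i → f i ≤ g i) → sumFin k f ≤ sumFin k g
  sumFin-mono zero    h = z≤n
  sumFin-mono (suc k) h = +-mono-≤ (h zero) (sumFin-mono k (λ i → h (suc i)))

  sumFin-cong : ∀ k {f g : Fin k → ℕ} → (∀ i → f i ≡ g i) → sumFin k f ≡ sumFin k g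
  sumFin-cong zero    h = refl
  sumFin-cong (suc k) h = cong₂ _+_ (h zero) (sumFin-cong k (λ i → h (suc i)))

  sumFin-const : ∀ k c → sumFin k (λ _ → c) ≡ k * c
  sumFin-const zero    c = refl
  sumFin-const (suc k) c = cong (c +_) (sumFin-const k c)

  sumFin-+ : ∀ k (f g : Fin k → ℕ) → sumFin k (λ i → f i + g i) ≡ sumFin k f + sumFin k g
  sumFin-+ zero    f g = refl
  sumFin-+ (suc k) f g
    rewrite sumFin-+ k (λ i → f (suc i)) (λ i → g (suc i)) =
    interchange (f zero) (g zero) (sumFin k (λ i → f (suc i))) (sumFin k (λ i → g (suc i)))
    where
    interchange : ∀ a b c d → (a + b) + (c + d) ≡ (a + c) + (b + d)
    interchange = solve-∀

  sumFin-*ˡ : ∀ k c (f : Fin k → ℕ) → sumFin k (λ i → c * f i) ≡ c * sumFin k f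
  sumFin-*ˡ zero    c f = sym (*-zeroʳ c)
  sumFin-*ˡ (suc k) c f
    rewrite sumFin-*ˡ k c (λ i → f (suc i)) = sym (*-distribˡ-+ c (f zero) _)

  sumFin-*ʳ : ∀ k c (f : Fin k → ℕ) → sumFin k (λ i → f i * c) ≡ sumFin k f * c
  sumFin-*ʳ k c f = trans (sumFin-cong k (λ i → *-comm (f i) c))
                          (trans (sumFin-*ˡ k c f) (*-comm c _))

  sumFin-swap : ∀ k l (f : Fin k → Fin l → ℕ) →
    sumFin k (λ i → sumFin l (f i)) ≡ sumFin l (λ j → sumFin k (λ i → f i j))
  sumFin-swap zero    l f = sym (trans (sumFin-const l 0) (*-zeroʳ l))
  sumFin-swap (suc k) l f
    rewrite sumFin-swap k l (λ i → f (suc i)) =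
    sym (sumFin-+ l (f zero) (λ j → sumFin k (λ i → f (suc i) j)))

  term≤sumFin : ∀ k (f : Fin k → ℕ) i → f i ≤ sumFin k f
  term≤sumFin (suc k) f zero    = m≤m+n _ _
  term≤sumFin (suc k) f (suc i) = ≤-trans (term≤sumFin k (λ j → f (suc j)) i) (m≤n+m _ (f zero))

  sumFin≡0⇒term≡0 : ∀ k {f : Fin k → ℕ} → sumFin k f ≡ 0 → ∀ i → f i ≡ 0
  sumFin≡0⇒term≡0 k {f} eq i = n≤0⇒n≡0 (subst (f i ≤_) eq (term≤sumFin k f i))

  sumFin-<⇒∃ : ∀ k (f g : Fin k → ℕ) → sumFin k f < sumFin k g → ∃ λ i → f i < g i
  sumFin-<⇒∃ (suc k) f g lt with f zero <? g zero
  ... | yes f₀<g₀ = zero , f₀<g₀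
  ... | no  f₀≮g₀ with sumFin-<⇒∃ k (λ i → f (suc i)) (λ i → g (suc i)) tail<
    where
    tail< : sumFin k (λ i → f (suc i)) < sumFin k (λ i → g (suc i))
    tail< = +-cancelˡ-< (g zero) _ _ (≤-<-trans (+-monoˡ-≤ _ (≮⇒≥ f₀≮g₀)) lt)
  ... | i , fi<gi = suc i , fi<gi

  -- Weak averaging: on a nonempty index set, adding one to every `g i` makes the comparison of sums
  -- strict, and `f i < 1 + g i` is the weak bound again.
  sumFin-≤⇒∃ : ∀ k (f g : Fin k → ℕ) → 0 < k → sumFin k f ≤ sumFin k g → ∃ λ i → f i ≤ g i
  sumFin-≤⇒∃ k f g 0<k le with sumFin-<⇒∃ k f (λ i → 1 + g i) shifted<
    where
    open ≤-Reasoning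
    shifted< : sumFin k f < sumFin k (λ i → 1 + g i)
    shifted< = begin-strict
      sumFin k f                     ≤⟨ le ⟩
      sumFin k g                     <⟨ m<n+m _ 0<k ⟩
      k + sumFin k g                 ≡⟨ cong (_+ sumFin k g) (*-identityʳ k) ⟨
      k * 1 + sumFin k g             ≡⟨ cong (_+ sumFin k g) (sumFin-const k 1) ⟨
      sumFin k (λ _ → 1) + sumFin k g ≡⟨ sumFin-+ k (λ _ → 1) g ⟨
      sumFin k (λ i → 1 + g i)       ∎
  ... | i , s≤s fi≤gi = i , fi≤gi

  -- Indicators and Boolean tests.

  𝟙≤1 : ∀ b → 𝟙 b ≤ 1
  𝟙≤1 true  = ≤-refl
  𝟙≤1 false = z≤n

  𝟙-∧ : ∀ x y → 𝟙 (x ∧ y) ≡ 𝟙 x * 𝟙 y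
  𝟙-∧ true  y = sym (+-identityʳ (𝟙 y))
  𝟙-∧ false y = refl

  𝟙≡0⇒false : ∀ {b} → 𝟙 b ≡ 0 → b ≡ false
  𝟙≡0⇒false {false} eq = refl

  𝟙*-monoʳ-≤ : ∀ b {x y} → (b ≡ true → x ≤ y) → 𝟙 b * x ≤ 𝟙 b * y
  𝟙*-monoʳ-≤ true  h = *-monoʳ-≤ 1 (h refl)
  𝟙*-monoʳ-≤ false h = z≤n

  𝟙-mono : ∀ x y → (x ≡ true → y ≡ true) → 𝟙 x ≤ 𝟙 y
  𝟙-mono true  y h rewrite h refl = ≤-refl
  𝟙-mono false y h = z≤n

  ∧-trueˡ : ∀ {x y} → x ∧ y ≡ true → x ≡ true
  ∧-trueˡ {true} eq = refl

  ∧-trueʳ : ∀ {x y} → x ∧ y ≡ true → y ≡ true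
  ∧-trueʳ {true} eq = eq

  <ᵇ≡true⇒< : ∀ m n → (m <ᵇ n) ≡ true → m < n
  <ᵇ≡true⇒< m n eq = <ᵇ⇒< m n (Equivalence.from T-≡ eq)

  <⇒<ᵇ≡true : ∀ {m n} → m < n → (m <ᵇ n) ≡ true
  <⇒<ᵇ≡true m<n = Equivalence.to T-≡ (<⇒<ᵇ m<n)

  <ᵇ≡false⇒≥ : ∀ m n → (m <ᵇ n) ≡ false → n ≤ m
  <ᵇ≡false⇒≥ m n eq = ≮⇒≥ λ m<n → not-¬ (<⇒<ᵇ≡true m<n) eq

  ≤ᵇ≡true⇒≤ : ∀ m n → (m ≤ᵇ n) ≡ true → m ≤ n
  ≤ᵇ≡true⇒≤ m n eq = ≤ᵇ⇒≤ m n (Equivalence.from T-≡ eq)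

  ≤⇒≤ᵇ≡true : ∀ {m n} → m ≤ n → (m ≤ᵇ n) ≡ true
  ≤⇒≤ᵇ≡true m≤n = Equivalence.to T-≡ (≤⇒≤ᵇ m≤n)

  _==_ : ∀ {k} → Fin k → Fin k → Bool
  i == j = does (i Fin.≟ j)

  ==-refl : ∀ {k} (i : Fin k) → (i == i) ≡ true
  ==-refl i with i Fin.≟ i
  ... | yes _   = refl
  ... | no  i≢i = ⊥-elim (i≢i refl)

  ==≡false⇒≢ : ∀ {k} {i j : Fin k} → (i == j) ≡ false → i ≢ j
  ==≡false⇒≢ {i = i} eq refl = not-¬ (==-refl i) eq

  sum-==≡1 : ∀ k (i : Fin k) → sumFin k (λ j → 𝟙 (i == j)) ≡ 1
  sum-==≡1 (suc k) zero    = cong suc (trans (sumFin-const k 0) (*-zeroʳ k))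
  sum-==≡1 (suc k) (suc i) = sum-==≡1 k i

  -- Counting the elements of a predicate.

  countTrue≤k : ∀ k (P : Fin k → Bool) → countTrue k P ≤ k
  countTrue≤k k P = begin
    countTrue k P      ≤⟨ sumFin-mono k (λ i → 𝟙≤1 (P i)) ⟩
    sumFin k (λ _ → 1) ≡⟨ trans (sumFin-const k 1) (*-identityʳ k) ⟩
    k                  ∎
    where open ≤-Reasoning

  countTrue-mono : ∀ k (P Q : Fin k → Bool) → (∀ i → P i ≡ true → Q i ≡ true) →
    countTrue k P ≤ countTrue k Q
  countTrue-mono k P Q h = sumFin-mono k (λ i → 𝟙-mono (P i) (Q i) (h i))

  -- The union bound behind every greedy choice: if the obstructions weigh less in total than there
  -- are candidates, some candidate has weight below 1, hence 0.
  countTrue-avoid : ∀ k (P : Fin k → Bool) (w : Fin k → ℕ) →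
    sumFin k (λ v → 𝟙 (P v) * w v) < countTrue k P → ∃ λ v → P v ≡ true × w v ≡ 0
  countTrue-avoid k P w lt with sumFin-<⇒∃ k _ (λ v → 𝟙 (P v)) lt
  ... | v , lt′ = v , split (P v) (w v) lt′
    where
    split : ∀ b x → 𝟙 b * x < 𝟙 b → b ≡ true × x ≡ 0
    split true x (s≤s x≤0) = refl , n≤0⇒n≡0 (≤-trans (m≤m+n x 0) x≤0)

  countTrue≡0⇒none : ∀ k (P : Fin k → Bool) → countTrue k P ≡ 0 → ∀ i → P i ≢ true
  countTrue≡0⇒none k P eq i Pi = not-¬ Pi (𝟙≡0⇒false (sumFin≡0⇒term≡0 k eq i))

  countTrue≡1⇒one : ∀ k (P : Fin k → Bool) → countTrue k P ≡ 1 →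
    ∃ λ x → ∀ i → P i ≡ true → i ≡ x
  countTrue≡1⇒one (suc k) P eq with P zero in P₀
  ... | true  = zero , λ { zero _ → refl
                         ; (suc i) Pi → ⊥-elim (countTrue≡0⇒none k _ (suc-injective eq) i Pi) }
  ... | false with countTrue≡1⇒one k (λ i → P (suc i)) eq
  ... | x , only = suc x , λ { zero Pi → ⊥-elim (not-¬ Pi P₀)
                             ; (suc i) Pi → cong suc (only i Pi) }

  -- Applied to the neighbourhood of a vertex of `U₂`, this produces the edge on `U₁` that the
  -- vertex subdivides.
  countTrue≡2⇒two : ∀ k (P : Fin k → Bool) → countTrue k P ≡ 2 →
    Σ (Fin k) λ x → Σ (Fin k) λ y → x ≢ y × (∀ i → P i ≡ true → i ≡ x ⊎ i ≡ y)
  countTrue≡2⇒two (suc k) P eq with P zero in P₀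
  ... | true with countTrue≡1⇒one k (λ i → P (suc i)) (suc-injective eq)
  ... | y , only = zero , suc y , (λ ()) ,
                   λ { zero _ → inj₁ refl ; (suc i) Pi → inj₂ (cong suc (only i Pi)) }
  countTrue≡2⇒two (suc k) P eq | false with countTrue≡2⇒two k (λ i → P (suc i)) eq
  ... | x , y , x≢y , only =
    suc x , suc y , (λ { refl → x≢y refl }) ,
    λ { zero Pi → ⊥-elim (not-¬ Pi P₀)
      ; (suc i) Pi → [ (λ e → inj₁ (cong suc e)) , (λ e → inj₂ (cong suc e)) ]′ (only i Pi) }

  -- Distinct representatives.

  -- Greedy, since every candidate set is at least as large as the number of values ever in use. The
  -- `f i` are the forbidden values; each chosen vertex joins them, so `a` grows as `b` shrinks and
  -- `a + b` is preserved.
  distinctRepresentatives : ∀ N a b (f : Fin a → Fin N) (P : Fin b → Fin N → Bool) →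
    (∀ j → a + b ≤ countTrue N (P j)) →
    Σ (Fin b → Fin N) λ h →
      (∀ j → P j (h j) ≡ true) × (∀ i j → f i ≢ h j) × (∀ j j′ → h j ≡ h j′ → j ≡ j′)
  distinctRepresentatives N a zero    f P large = (λ ()) , (λ ()) , (λ _ ()) , (λ ())
  distinctRepresentatives N a (suc b) f P large =
    h⁺ , (λ { zero → Pv ; (suc j) → Ph j })
       , (λ { i zero → f≢v i ; i (suc j) → apart (suc i) j })
       , (λ { zero zero _ → refl
            ; zero (suc j) e → ⊥-elim (apart zero j e)
            ; (suc j) zero e → ⊥-elim (apart zero j (sym e))
            ; (suc j) (suc j′) e → cong suc (inj j j′ e) })
    where
    open ≤-Reasoning
    hits : Fin N → ℕ
    hits v = sumFin a (λ i → 𝟙 (f i == v))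
    -- Each forbidden value hits exactly one vertex, so the hits add up to at most `a`.
    fewHits : sumFin N (λ v → 𝟙 (P zero v) * hits v) < countTrue N (P zero)
    fewHits = begin-strict
      sumFin N (λ v → 𝟙 (P zero v) * hits v)         ≤⟨ sumFin-mono N (λ v → *-monoˡ-≤ (hits v) (𝟙≤1 (P zero v))) ⟩
      sumFin N (λ v → 1 * hits v)                    ≡⟨ sumFin-cong N (λ v → *-identityˡ (hits v)) ⟩
      sumFin N hits                                  ≡⟨ sumFin-swap N a (λ v i → 𝟙 (f i == v)) ⟩
      sumFin a (λ i → sumFin N (λ v → 𝟙 (f i == v))) ≡⟨ sumFin-cong a (λ i → sum-==≡1 N (f i)) ⟩
      sumFin a (λ _ → 1)                             ≡⟨ trans (sumFin-const a 1) (*-identityʳ a) ⟩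
      a                                              <⟨ m<m+n a (s≤s z≤n) ⟩
      a + suc b                                      ≤⟨ large zero ⟩
      countTrue N (P zero)                           ∎
    first = countTrue-avoid N (P zero) hits fewHits
    v = proj₁ first
    Pv = proj₁ (proj₂ first)
    f≢v : ∀ i → f i ≢ v
    f≢v i = ==≡false⇒≢ (𝟙≡0⇒false (sumFin≡0⇒term≡0 a (proj₂ (proj₂ first)) i))
    f⁺ : Fin (suc a) → Fin N
    f⁺ zero    = v
    f⁺ (suc i) = f i
    rest = distinctRepresentatives N (suc a) b f⁺ (λ j → P (suc j))
             (λ j → subst (_≤ countTrue N (P (suc j))) (+-suc a b) (large (suc j)))
    Ph = proj₁ (proj₂ rest)
    apart = proj₁ (proj₂ (proj₂ rest))
    inj = proj₂ (proj₂ (proj₂ rest))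
    h⁺ : Fin (suc b) → Fin N
    h⁺ zero    = v
    h⁺ (suc j) = proj₁ rest j

  -- Bad pairs and random neighbourhoods.

  module DependentRandomChoice {N : ℕ} (G : Graph N) (n : ℕ) where

    deg : Fin N → ℕ
    deg v = countTrue N (adj G v)

    codeg : Fin N → Fin N → ℕ
    codeg v w = countTrue N (λ x → adj G v x ∧ adj G w x)

    bad : Fin N → Fin N → Bool
    bad v w = codeg v w <ᵇ n

    bad-sym : ∀ v w → bad v w ≡ bad w v
    bad-sym v w = cong (_<ᵇ n) (sumFin-cong N (λ x → cong 𝟙 (∧-comm (adj G v x) (adj G w x))))

    size : (Fin N → Bool) → ℕ
    size = countTrue N

    badDeg : (Fin N → Bool) → Fin N → ℕ
    badDeg A v = countTrue N (λ w → A w ∧ bad v w)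

    -- Pairs are ordered and the diagonal is included: a vertex is bad with itself when its degree
    -- is below `n`.
    badPairs : (Fin N → Bool) → ℕ
    badPairs A = sumFin N (λ v → 𝟙 (A v) * badDeg A v)

    badDeg≤size : ∀ A v → badDeg A v ≤ size A
    badDeg≤size A v = countTrue-mono N _ A (λ w → ∧-trueˡ)

    badDeg-mono : ∀ A A′ → (∀ v → A v ≡ true → A′ v ≡ true) → ∀ v → badDeg A v ≤ badDeg A′ v
    badDeg-mono A A′ A⊆A′ v = countTrue-mono N _ _ (λ w e → and (A⊆A′ w (∧-trueˡ e)) (∧-trueʳ {A w} e))
      where
      and : ∀ {x y} → x ≡ true → y ≡ true → x ∧ y ≡ true
      and refl refl = refl

    infixl 6 _∩N_
    _∩N_ : (Fin N → Bool) → Fin N → Fin N → Bool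
    (A ∩N x) v = A v ∧ adj G x v

    -- `edgeCount` counts an edge at its smaller end, and swapping the sums counts it at its larger
    -- end; an ordered pair of vertices is met in at most one of the two counts.
    2edgeCount≤degreeSum : 2 * edgeCount G ≤ sumFin N deg
    2edgeCount≤degreeSum = begin
      2 * edgeCount G               ≡⟨ cong (edgeCount G +_) (+-identityʳ (edgeCount G)) ⟩
      edgeCount G + edgeCount G     ≡⟨ cong (edgeCount G +_) (sumFin-swap N N up) ⟩
      edgeCount G + sumFin N (λ i → sumFin N (λ j → up j i))
                                    ≡⟨ sumFin-+ N _ _ ⟨
      sumFin N (λ i → sumFin N (up i) + sumFin N (λ j → up j i))
                                    ≡⟨ sumFin-cong N (λ i → sumFin-+ N (up i) _) ⟨
      sumFin N (λ i → sumFin N (λ j → up i j + up j i))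
                                    ≤⟨ sumFin-mono N (λ i → sumFin-mono N (λ j → once i j)) ⟩
      sumFin N deg                  ∎
      where
      open ≤-Reasoning
      up : Fin N → Fin N → ℕ
      up i j = 𝟙 ((toℕ i <ᵇ toℕ j) ∧ adj G i j)
      once : ∀ i j → up i j + up j i ≤ 𝟙 (adj G i j)
      once i j rewrite adj-sym G j i with toℕ i <ᵇ toℕ j in i<j | toℕ j <ᵇ toℕ i in j<i
      ... | true  | true  = ⊥-elim (<-asym (<ᵇ≡true⇒< (toℕ i) (toℕ j) i<j) (<ᵇ≡true⇒< (toℕ j) (toℕ i) j<i))
      ... | true  | false = ≤-reflexive (+-identityʳ _)
      ... | false | true  = ≤-refl
      ... | false | false = z≤n

    -- Double counting of the adjacent pairs `(x , v)` with `v` in `A`. Divided by `N`, it is the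
    -- expected size of `A ∩N x` for random `x`.
    neighbourhoodSizes : ∀ A → sumFin N (λ x → size (A ∩N x)) ≡ sumFin N (λ v → 𝟙 (A v) * deg v)
    neighbourhoodSizes A = begin
      sumFin N (λ x → sumFin N (λ v → 𝟙 (A v ∧ adj G x v))) ≡⟨ sumFin-swap N N _ ⟩
      sumFin N (λ v → sumFin N (λ x → 𝟙 (A v ∧ adj G x v))) ≡⟨ sumFin-cong N inner ⟩
      sumFin N (λ v → 𝟙 (A v) * deg v)                      ∎
      where
      open ≡-Reasoning
      inner : ∀ v → sumFin N (λ x → 𝟙 (A v ∧ adj G x v)) ≡ 𝟙 (A v) * deg v
      inner v = trans (sumFin-cong N (λ x → trans (𝟙-∧ (A v) _) (cong (λ e → 𝟙 (A v) * 𝟙 e) (adj-sym G x v))))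
                      (sumFin-*ˡ N (𝟙 (A v)) _)

    -- A bad pair survives in A ∩N x only if x is one of its fewer than n common neighbours.
    neighbourhoodBadPairs : ∀ A → sumFin N (λ x → badPairs (A ∩N x)) ≤ n * badPairs A
    neighbourhoodBadPairs A = begin
      sumFin N (λ x → badPairs (A ∩N x))
        ≡⟨ sumFin-cong N (λ x → sumFin-cong N (λ v → sumFin-*ˡ N (𝟙 ((A ∩N x) v)) _)) ⟨
      sumFin N (λ x → sumFin N (λ v → sumFin N (λ w → 𝟙 (A v ∧ adj G x v) * 𝟙 ((A w ∧ adj G x w) ∧ bad v w))))
        ≡⟨ sumFin-swap N N _ ⟩
      sumFin N (λ v → sumFin N (λ x → sumFin N (λ w → 𝟙 (A v ∧ adj G x v) * 𝟙 ((A w ∧ adj G x w) ∧ bad v w))))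
        ≡⟨ sumFin-cong N (λ v → sumFin-swap N N _) ⟩
      sumFin N (λ v → sumFin N (λ w → sumFin N (λ x → 𝟙 (A v ∧ adj G x v) * 𝟙 ((A w ∧ adj G x w) ∧ bad v w))))
        ≤⟨ sumFin-mono N (λ v → sumFin-mono N (λ w → pair v w)) ⟩
      sumFin N (λ v → sumFin N (λ w → n * (𝟙 (A v) * 𝟙 (A w ∧ bad v w))))
        ≡⟨ sumFin-cong N (λ v → sumFin-*ˡ N n _) ⟩
      sumFin N (λ v → n * sumFin N (λ w → 𝟙 (A v) * 𝟙 (A w ∧ bad v w)))
        ≡⟨ sumFin-*ˡ N n _ ⟩
      n * sumFin N (λ v → sumFin N (λ w → 𝟙 (A v) * 𝟙 (A w ∧ bad v w)))
        ≡⟨ cong (n *_) (sumFin-cong N (λ v → sumFin-*ˡ N (𝟙 (A v)) _)) ⟩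
      n * badPairs A ∎
      where
      open ≤-Reasoning
      -- Separates the condition on the pair from the condition that `x` is a common neighbour, so
      -- that summing over `x` yields `codeg`.
      factor : ∀ a b c d e → 𝟙 (a ∧ b) * 𝟙 ((c ∧ d) ∧ e) ≡ 𝟙 (a ∧ (c ∧ e)) * 𝟙 (b ∧ d)
      factor false b     c     d     e     = refl
      factor true  false false d     e     = refl
      factor true  true  false d     e     = refl
      factor true  false true  d     e     = sym (*-zeroʳ (𝟙 e))
      factor true  true  true  false e     = sym (*-zeroʳ (𝟙 e))
      factor true  true  true  true  e     = trans (+-identityʳ (𝟙 e)) (sym (*-identityʳ (𝟙 e)))
      pair : ∀ v w → sumFin N (λ x → 𝟙 (A v ∧ adj G x v) * 𝟙 ((A w ∧ adj G x w) ∧ bad v w))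
                     ≤ n * (𝟙 (A v) * 𝟙 (A w ∧ bad v w))
      pair v w = begin
        sumFin N (λ x → 𝟙 (A v ∧ adj G x v) * 𝟙 ((A w ∧ adj G x w) ∧ bad v w))
          ≡⟨ sumFin-cong N (λ x → trans (factor (A v) (adj G x v) (A w) (adj G x w) (bad v w))
               (cong₂ (λ s t → 𝟙 (A v ∧ (A w ∧ bad v w)) * 𝟙 (s ∧ t)) (adj-sym G x v) (adj-sym G x w))) ⟩
        sumFin N (λ x → 𝟙 (A v ∧ (A w ∧ bad v w)) * 𝟙 (adj G v x ∧ adj G w x))
          ≡⟨ sumFin-*ˡ N (𝟙 (A v ∧ (A w ∧ bad v w))) _ ⟩
        𝟙 (A v ∧ (A w ∧ bad v w)) * codeg v w
          ≤⟨ 𝟙*-monoʳ-≤ (A v ∧ (A w ∧ bad v w))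
               (λ e → <⇒≤ (<ᵇ≡true⇒< _ n (∧-trueʳ {A w} (∧-trueʳ {A v} e)))) ⟩
        𝟙 (A v ∧ (A w ∧ bad v w)) * n
          ≡⟨ trans (*-comm _ n) (cong (n *_) (𝟙-∧ (A v) _)) ⟩
        n * (𝟙 (A v) * 𝟙 (A w ∧ bad v w)) ∎

    -- Markov's inequality: a discarded vertex lies in more than `size X / K` bad pairs, and the
    -- bound on `badPairs X` leaves room for at most half of `X` to be like that.
    prune : ∀ (X : Fin N → Bool) K → 0 < size X → 2 * K * badPairs X ≤ size X * size X →
      Σ (Fin N → Bool) λ A →
        (∀ v → A v ≡ true → X v ≡ true) ×
        (∀ v → A v ≡ true → K * badDeg X v ≤ size X) ×
        size X ≤ 2 * size A
    prune X K 0<X few = A , (λ v → ∧-trueˡ) , (λ v e → ≤ᵇ≡true⇒≤ _ _ (∧-trueʳ {X v} e)) , half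
      where
      open ≤-Reasoning
      kept : Fin N → Bool
      kept v = K * badDeg X v ≤ᵇ size X
      A : Fin N → Bool
      A v = X v ∧ kept v
      instance
        nz : NonZero (size X)
        nz = >-nonZero 0<X
      -- Every vertex of `X` accounts for `size X`: a kept one through the first summand, a
      -- discarded one through its bad degree.
      charge : ∀ v → 𝟙 (X v) * size X ≤ 𝟙 (A v) * size X + K * (𝟙 (X v) * badDeg X v)
      charge v with X v
      ... | false = z≤n
      ... | true with K * badDeg X v ≤ᵇ size X in eq
      ... | true  = m≤m+n _ _
      ... | false = begin
        1 * size X           ≡⟨ *-identityˡ (size X) ⟩
        size X               ≤⟨ ≰⇒≥ (λ le → not-¬ (≤⇒≤ᵇ≡true le) eq) ⟩
        K * badDeg X v       ≡⟨ cong (K *_) (*-identityˡ (badDeg X v)) ⟨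
        K * (1 * badDeg X v) ∎
      total : size X * size X ≤ size A * size X + K * badPairs X
      total = begin
        size X * size X                                  ≡⟨ sumFin-*ʳ N (size X) _ ⟨
        sumFin N (λ v → 𝟙 (X v) * size X)                ≤⟨ sumFin-mono N charge ⟩
        sumFin N (λ v → 𝟙 (A v) * size X + K * (𝟙 (X v) * badDeg X v))
                                                         ≡⟨ sumFin-+ N _ _ ⟩
        sumFin N (λ v → 𝟙 (A v) * size X) + sumFin N (λ v → K * (𝟙 (X v) * badDeg X v))
                                                         ≡⟨ cong₂ _+_ (sumFin-*ʳ N (size X) _) (sumFin-*ˡ N K _) ⟩
        size A * size X + K * badPairs X                 ∎
      double : ∀ a x y → 2 * (a * x + y) ≡ (2 * a) * x + 2 * y
      double = solve-∀
      half : size X ≤ 2 * size A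
      half = *-cancelʳ-≤ (size X) (2 * size A) (size X) (+-cancelʳ-≤ (size X * size X) _ _ (begin
        size X * size X + size X * size X                ≡⟨ cong (size X * size X +_) (+-identityʳ (size X * size X)) ⟨
        2 * (size X * size X)                            ≤⟨ *-monoʳ-≤ 2 total ⟩
        2 * (size A * size X + K * badPairs X)           ≡⟨ double (size A) (size X) (K * badPairs X) ⟩
        2 * size A * size X + 2 * (K * badPairs X)       ≡⟨ cong (2 * size A * size X +_) (*-assoc 2 K (badPairs X)) ⟨
        2 * size A * size X + 2 * K * badPairs X         ≤⟨ +-monoʳ-≤ (2 * size A * size X) few ⟩
        2 * size A * size X + size X * size X            ∎))

    -- ε = p / r, with denominators cleared.
    module Density (p r : ℕ) (0<p : 0 < p) (0<r : 0 < r) (0<n : 0 < n)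
      (manyVertices : 128 * n * (r * r * r) ≤ p * p * p * N)
      (manyEdges : p * (N * N) ≤ edgeCount G * r) where

      -- Consequences of the density hypotheses.

      0<N : 0 < N
      0<N = positive N manyVertices
        where
        positive : ∀ M → 128 * n * (r * r * r) ≤ p * p * p * M → 0 < M
        positive (suc M) _  = s≤s z≤n
        positive zero    le with ≤-trans (*-mono-≤ (*-mono-≤ {1} {128} (s≤s z≤n) 0<n)
                                   (*-mono-≤ (*-mono-≤ 0<r 0<r) 0<r))
                                   (≤-trans le (≤-reflexive (*-zeroʳ (p * p * p))))
        ... | ()

      instance
        nzN : NonZero N
        nzN = >-nonZero 0<N
        nzp : NonZero p
        nzp = >-nonZero 0<p
        nzr : NonZero r
        nzr = >-nonZero 0<r
        nzn : NonZero n
        nzn = >-nonZero 0<n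

      0<pN : 0 < p * N
      0<pN = *-mono-≤ 0<p 0<N

      highDegree : Fin N → Bool
      highDegree v = p * N ≤ᵇ r * deg v

      -- The degrees sum to at least `2εN²`. Vertices below `εN` contribute at most `εN²`, and each
      -- of the others at most `N`, so there are at least `εN` others.
      manyHighDegree : p * N ≤ size highDegree * r
      manyHighDegree = *-cancelʳ-≤ (p * N) (size highDegree * r) N (+-cancelʳ-≤ (N * (p * N)) _ _ (begin
        p * N * N + N * (p * N)                           ≡⟨ doubled p N ⟩
        2 * (p * (N * N))                                 ≤⟨ *-monoʳ-≤ 2 manyEdges ⟩
        2 * (edgeCount G * r)                             ≡⟨ regroup r (edgeCount G) ⟩
        r * (2 * edgeCount G)                             ≤⟨ *-monoʳ-≤ r 2edgeCount≤degreeSum ⟩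
        r * sumFin N deg                                  ≡⟨ sumFin-*ˡ N r deg ⟨
        sumFin N (λ v → r * deg v)                        ≤⟨ sumFin-mono N bound ⟩
        sumFin N (λ v → 𝟙 (highDegree v) * (r * N) + p * N)
                                                          ≡⟨ sumFin-+ N _ _ ⟩
        sumFin N (λ v → 𝟙 (highDegree v) * (r * N)) + sumFin N (λ _ → p * N)
                                                          ≡⟨ cong₂ _+_ (sumFin-*ʳ N (r * N) _) (sumFin-const N (p * N)) ⟩
        size highDegree * (r * N) + N * (p * N)           ≡⟨ cong (_+ N * (p * N)) (*-assoc (size highDegree) r N) ⟨
        size highDegree * r * N + N * (p * N)             ∎))
        where
        open ≤-Reasoning
        doubled : ∀ p N → p * N * N + N * (p * N) ≡ 2 * (p * (N * N))
        doubled = solve-∀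
        regroup : ∀ r e → 2 * (e * r) ≡ r * (2 * e)
        regroup = solve-∀
        bound : ∀ v → r * deg v ≤ 𝟙 (highDegree v) * (r * N) + p * N
        bound v with p * N ≤ᵇ r * deg v in eq
        ... | true  = ≤-trans (*-monoʳ-≤ r (countTrue≤k N (adj G v)))
                              (≤-trans (≤-reflexive (sym (*-identityˡ (r * N)))) (m≤m+n _ _))
        ... | false = ≰⇒≥ (λ le → not-¬ (≤⇒≤ᵇ≡true le) eq)

      -- That is, `ε ≤ 1`: at least `εN` of the `N` vertices have high degree.
      p≤r : p ≤ r
      p≤r = *-cancelʳ-≤ p r N (begin
        p * N                 ≤⟨ manyHighDegree ⟩
        size highDegree * r   ≤⟨ *-monoˡ-≤ r (countTrue≤k N highDegree) ⟩
        N * r                 ≡⟨ *-comm N r ⟩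
        r * N                 ∎)
        where open ≤-Reasoning

      -- An integer between 4/ε and 8/ε; each step of the construction makes bad pairs g times rarer.
      g : ℕ
      g = suc (4 * r / p)

      4r≤gp : 4 * r ≤ g * p
      4r≤gp = begin
        4 * r                         ≡⟨ m≡m%n+[m/n]*n (4 * r) p ⟩
        4 * r % p + 4 * r / p * p     ≤⟨ +-monoˡ-≤ _ (<⇒≤ (m%n<n (4 * r) p)) ⟩
        p + 4 * r / p * p             ∎
        where
        open ≤-Reasoning

      gp≤8r : g * p ≤ 8 * r
      gp≤8r = begin
        -- Rounding up costs one `p`, at most `r`. The resulting `5 * r` is relaxed to `8 * r`, to
        -- match `128 = 16 * 8` below.
        p + 4 * r / p * p  ≤⟨ +-mono-≤ p≤r (m/n*n≤m (4 * r) p) ⟩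
        r + 4 * r          ≤⟨ m≤m+n _ (3 * r) ⟩
        r + 4 * r + 3 * r  ≡⟨ eight r ⟩
        8 * r              ∎
        where
        open ≤-Reasoning
        eight : ∀ r → r + 4 * r + 3 * r ≡ 8 * r
        eight = solve-∀

      4≤g : 4 ≤ g
      4≤g = *-cancelʳ-≤ 4 g p (≤-trans (*-monoʳ-≤ 4 p≤r) 4r≤gp)

      -- In terms of ε, `16gn ≤ ε²N`: one factor ε of the hypothesis on `N` is spent on `g ≤ 8/ε`.
      16gr²n≤p²N : 16 * g * (r * r) * n ≤ p * p * N
      16gr²n≤p²N = *-cancelʳ-≤ _ _ p (begin
        16 * g * (r * r) * n * p     ≡⟨ collect g r n p ⟩
        16 * (r * r) * n * (g * p)   ≤⟨ *-monoʳ-≤ (16 * (r * r) * n) gp≤8r ⟩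
        16 * (r * r) * n * (8 * r)   ≡⟨ expand r n ⟩
        128 * n * (r * r * r)        ≤⟨ manyVertices ⟩
        p * p * p * N                ≡⟨ reorder p N ⟩
        p * p * N * p                ∎)
        where
        open ≤-Reasoning
        collect : ∀ g r n p → 16 * g * (r * r) * n * p ≡ 16 * (r * r) * n * (g * p)
        collect = solve-∀
        expand : ∀ r n → 16 * (r * r) * n * (8 * r) ≡ 128 * n * (r * r * r)
        expand = solve-∀
        reorder : ∀ p N → p * p * p * N ≡ p * p * N * p
        reorder = solve-∀

      -- Sparse sets and the refinement step.

      -- The invariant of the nested sets, with `B` equal to `g ^ s` after `s` steps. The same `B`
      -- measures the gain and the loss: bad degrees are at most `size A / B`, and the size is at
      -- least `εN / B`.
      record Sparse (A : Fin N → Bool) (B : ℕ) : Set where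
        field
          positive : 0 < B
          degrees  : ∀ v → A v ≡ true → p * N ≤ r * deg v
          badDegs  : ∀ v → A v ≡ true → B * badDeg A v ≤ size A
          large    : p * N ≤ size A * B * r
      open Sparse

      highDegree-sparse : Sparse highDegree 1
      highDegree-sparse .positive = s≤s z≤n
      highDegree-sparse .degrees v e = ≤ᵇ≡true⇒≤ _ _ e
      highDegree-sparse .badDegs v e = ≤-trans (≤-reflexive (*-identityˡ _)) (badDeg≤size highDegree v)
      highDegree-sparse .large =
        subst (λ s → p * N ≤ s * r) (sym (*-identityʳ (size highDegree))) manyHighDegree

      sparse⇒nonempty : ∀ {A B} → Sparse A B → 0 < size A
      sparse⇒nonempty {A} {B} sp = nonzero (size A) (≤-trans 0<pN (large sp))
        where
        nonzero : ∀ s → 0 < s * B * r → 0 < s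
        nonzero (suc s) _ = s≤s z≤n

      module _ {A : Fin N → Bool} {B : ℕ} (sp : Sparse A B) where
        private
          α = size A
          instance
            nzα : NonZero α
            nzα = >-nonZero (sparse⇒nonempty sp)

        badPairs-sparse : B * badPairs A ≤ α * α
        badPairs-sparse = begin
          B * badPairs A                                ≡⟨ sumFin-*ˡ N B _ ⟨
          sumFin N (λ v → B * (𝟙 (A v) * badDeg A v))   ≡⟨ sumFin-cong N (λ v → exchange B (𝟙 (A v)) (badDeg A v)) ⟩
          sumFin N (λ v → 𝟙 (A v) * (B * badDeg A v))   ≤⟨ sumFin-mono N (λ v → 𝟙*-monoʳ-≤ (A v) (badDegs sp v)) ⟩
          sumFin N (λ v → 𝟙 (A v) * α)                  ≡⟨ sumFin-*ʳ N α _ ⟩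
          α * α                                         ∎
          where
          open ≤-Reasoning
          exchange : ∀ x y z → x * (y * z) ≡ y * (x * z)
          exchange = solve-∀

        -- All degrees in `A` are at least `εN`, so a random neighbourhood meets `A` in at least
        -- `εα` vertices on average.
        neighbourhoods-large : α * (p * N) ≤ r * sumFin N (λ x → size (A ∩N x))
        neighbourhoods-large = begin
          α * (p * N)                                ≡⟨ sumFin-*ʳ N (p * N) _ ⟨
          sumFin N (λ v → 𝟙 (A v) * (p * N))         ≤⟨ sumFin-mono N (λ v → 𝟙*-monoʳ-≤ (A v) (degrees sp v)) ⟩
          sumFin N (λ v → 𝟙 (A v) * (r * deg v))     ≡⟨ sumFin-cong N (λ v → exchange (𝟙 (A v)) r (deg v)) ⟩
          sumFin N (λ v → r * (𝟙 (A v) * deg v))     ≡⟨ sumFin-*ˡ N r _ ⟩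
          r * sumFin N (λ v → 𝟙 (A v) * deg v)       ≡⟨ cong (r *_) (neighbourhoodSizes A) ⟨
          r * sumFin N (λ x → size (A ∩N x))         ∎
          where
          open ≤-Reasoning
          exchange : ∀ x y z → x * (y * z) ≡ y * (x * z)
          exchange = solve-∀

        -- One average serves two purposes. After summing over `x`, each summand on the left is at
        -- most `n * (α * α) * p * N`, and the right side is at least twice that. At the `x` found,
        -- dropping either summand leaves a bound: `size X ≥ εα / 2`, or few bad pairs relative to
        -- `size X`.
        goodNeighbourhood : ∃ λ x →
          n * (α * α) * p + p * N * B * badPairs (A ∩N x) ≤ 2 * r * n * α * size (A ∩N x)
        goodNeighbourhood = sumFin-≤⇒∃ N _ _ 0<N (begin
          sumFin N (λ x → n * (α * α) * p + p * N * B * badPairs (A ∩N x))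
            ≡⟨ sumFin-+ N _ _ ⟩
          sumFin N (λ _ → n * (α * α) * p) + sumFin N (λ x → p * N * B * badPairs (A ∩N x))
            ≡⟨ cong₂ _+_ (sumFin-const N _) (sumFin-*ˡ N (p * N * B) _) ⟩
          N * (n * (α * α) * p) + p * N * B * sumFin N (λ x → badPairs (A ∩N x))
            ≤⟨ +-monoʳ-≤ _ (*-monoʳ-≤ (p * N * B) (neighbourhoodBadPairs A)) ⟩
          N * (n * (α * α) * p) + p * N * B * (n * badPairs A)
            ≡⟨ cong (N * (n * (α * α) * p) +_) (bring p N B n (badPairs A)) ⟩
          N * (n * (α * α) * p) + p * N * n * (B * badPairs A)
            ≤⟨ +-monoʳ-≤ _ (*-monoʳ-≤ (p * N * n) badPairs-sparse) ⟩
          N * (n * (α * α) * p) + p * N * n * (α * α)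
            ≡⟨ merge N n α p ⟩
          2 * n * α * (α * (p * N))
            ≤⟨ *-monoʳ-≤ (2 * n * α) neighbourhoods-large ⟩
          2 * n * α * (r * sumFin N (λ x → size (A ∩N x)))
            ≡⟨ shuffle n α r _ ⟩
          2 * r * n * α * sumFin N (λ x → size (A ∩N x))
            ≡⟨ sumFin-*ˡ N (2 * r * n * α) _ ⟨
          sumFin N (λ x → 2 * r * n * α * size (A ∩N x)) ∎)
          where
          open ≤-Reasoning
          bring : ∀ p N B n y → p * N * B * (n * y) ≡ p * N * n * (B * y)
          bring = solve-∀
          merge : ∀ N n α p → N * (n * (α * α) * p) + p * N * n * (α * α) ≡ 2 * n * α * (α * (p * N))
          merge = solve-∀
          shuffle : ∀ n α r s → 2 * n * α * (r * s) ≡ 2 * r * n * α * s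
          shuffle = solve-∀

        -- Intersect with the good neighbourhood, then prune. Degrees are taken in `G`, so their
        -- lower bound is inherited by subsets.
        refine : Σ (Fin N → Bool) λ A′ → (∀ v → A′ v ≡ true → A v ≡ true) × Sparse A′ (g * B)
        refine = A′ , (λ v e → ∧-trueˡ (A′⊆X v e)) , record
          { positive = *-mono-≤ {1} {g} {1} {B} (s≤s z≤n) (positive sp)
          ; degrees  = λ v e → degrees sp v (∧-trueˡ (A′⊆X v e))
          ; badDegs  = λ v e → *-cancelˡ-≤ 2 (begin
              2 * (g * B * badDeg A′ v)  ≡⟨ *-assoc 2 (g * B) (badDeg A′ v) ⟨
              2 * (g * B) * badDeg A′ v  ≤⟨ *-monoʳ-≤ (2 * (g * B)) (badDeg-mono A′ X A′⊆X v) ⟩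
              2 * (g * B) * badDeg X v   ≤⟨ proj₁ (proj₂ (proj₂ pruned)) v e ⟩
              size X                     ≤⟨ X≤2A′ ⟩
              2 * size A′                ∎)
          -- The neighbourhood costs a factor `2/ε` and pruning a factor 2; together this is `4/ε`,
          -- at most `g`.
          ; large    = *-cancelˡ-≤ p (begin
              p * (p * N)                   ≤⟨ *-monoʳ-≤ p (large sp) ⟩
              p * (α * B * r)               ≡⟨ front p α B r ⟩
              α * p * (B * r)               ≤⟨ *-monoˡ-≤ (B * r) X-large ⟩
              2 * r * size X * (B * r)      ≤⟨ *-monoˡ-≤ (B * r) (*-monoʳ-≤ (2 * r) X≤2A′) ⟩
              2 * r * (2 * size A′) * (B * r) ≡⟨ isolate r (size A′) B ⟩
              size A′ * B * r * (4 * r)     ≤⟨ *-monoʳ-≤ (size A′ * B * r) 4r≤gp ⟩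
              size A′ * B * r * (g * p)     ≡⟨ back (size A′) B r g p ⟩
              p * (size A′ * (g * B) * r)   ∎)
          }
          where
          open ≤-Reasoning
          x = proj₁ goodNeighbourhood
          choice = proj₂ goodNeighbourhood
          X : Fin N → Bool
          X = A ∩N x
          front : ∀ p α B r → p * (α * B * r) ≡ α * p * (B * r)
          front = solve-∀
          isolate : ∀ r a B → 2 * r * (2 * a) * (B * r) ≡ a * B * r * (4 * r)
          isolate = solve-∀
          back : ∀ a B r g p → a * B * r * (g * p) ≡ p * (a * (g * B) * r)
          back = solve-∀

          instance
            nznα : NonZero (n * α)
            nznα = m*n≢0 n α
            nzp²N : NonZero (p * p * N)
            nzp²N = m*n≢0 (p * p) N {{m*n≢0 p p}}

          X-large : α * p ≤ 2 * r * size X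
          X-large = *-cancelˡ-≤ (n * α) (begin
            n * α * (α * p)                ≡⟨ left n α p ⟩
            n * (α * α) * p                ≤⟨ m+n≤o⇒m≤o _ choice ⟩
            2 * r * n * α * size X         ≡⟨ right r n α (size X) ⟩
            n * α * (2 * r * size X)       ∎)
            where
            left : ∀ n α p → n * α * (α * p) ≡ n * (α * α) * p
            left = solve-∀
            right : ∀ r n α s → 2 * r * n * α * s ≡ n * α * (2 * r * s)
            right = solve-∀

          X-nonempty : 0 < size X
          X-nonempty = nonzero (size X) (≤-trans (*-mono-≤ (sparse⇒nonempty sp) 0<p) X-large)
            where
            nonzero : ∀ s → 0 < 2 * r * s → 0 < s
            nonzero (suc s) _  = s≤s z≤n
            nonzero zero    lt = ⊥-elim (<-irrefl (sym (*-zeroʳ (2 * r))) lt)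

          -- The choice of `x` bounds the bad pairs by `2nα * size X / (εNB)`. Replacing `α` by
          -- `2 * size X / ε` gives `4n * (size X)² / (ε²NB)`, and `16gn ≤ ε²N` finishes.
          X-fewBadPairs : 2 * (2 * (g * B)) * badPairs X ≤ size X * size X
          X-fewBadPairs = *-cancelˡ-≤ (p * p * N) (begin
            p * p * N * (2 * (2 * (g * B)) * badPairs X)
              ≡⟨ expose p N g B (badPairs X) ⟩
            4 * g * p * (p * N * B * badPairs X)
              ≤⟨ *-monoʳ-≤ (4 * g * p) (m+n≤o⇒n≤o (n * (α * α) * p) choice) ⟩
            4 * g * p * (2 * r * n * α * size X)
              ≡⟨ gather g p r n α (size X) ⟩
            8 * g * r * n * size X * (α * p)
              ≤⟨ *-monoʳ-≤ (8 * g * r * n * size X) X-large ⟩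
            8 * g * r * n * size X * (2 * r * size X)
              ≡⟨ square g r n (size X) ⟩
            16 * g * (r * r) * n * (size X * size X)
              ≤⟨ *-monoˡ-≤ (size X * size X) 16gr²n≤p²N ⟩
            p * p * N * (size X * size X) ∎)
            where
            expose : ∀ p N g B y → p * p * N * (2 * (2 * (g * B)) * y) ≡ 4 * g * p * (p * N * B * y)
            expose = solve-∀
            gather : ∀ g p r n α s → 4 * g * p * (2 * r * n * α * s) ≡ 8 * g * r * n * s * (α * p)
            gather = solve-∀
            square : ∀ g r n s → 8 * g * r * n * s * (2 * r * s) ≡ 16 * g * (r * r) * n * (s * s)
            square = solve-∀

          -- The parameter is twice `g * B` because `prune` bounds bad degrees relative to `size X`,
          -- which can be twice `size A′`.
          pruned = prune X (2 * (g * B)) X-nonempty X-fewBadPairs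
          A′ = proj₁ pruned
          A′⊆X = proj₁ (proj₂ pruned)
          X≤2A′ = proj₂ (proj₂ (proj₂ pruned))

      -- The edges are {e₁ j , e₂ j}. Outside S the values of a placement are junk, but still in A.
      module Multigraph {a b : ℕ} (e₁ e₂ : Fin b → Fin a) (e₁≢e₂ : ∀ j → e₁ j ≢ e₂ j)
        (a+b≡n : a + b ≡ n) where

        -- Partial placements of `U₁`.

        record Placement (A : Fin N → Bool) (S : Fin a → Set) : Set where
          field
            f    : Fin a → Fin N
            into : ∀ i → A (f i) ≡ true
            inj  : ∀ i i′ → S i → S i′ → f i ≡ f i′ → i ≡ i′
            good : ∀ j → S (e₁ j) → S (e₂ j) → bad (f (e₁ j)) (f (e₂ j)) ≡ false
        open Placement

        weaken : ∀ {A A′ S S′} → (∀ v → A v ≡ true → A′ v ≡ true) → (∀ i → S′ i → S i) →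
          Placement A S → Placement A′ S′
        weaken A⊆A′ S′⊆S P = record
          { f    = f P
          ; into = λ i → A⊆A′ _ (into P i)
          ; inj  = λ i i′ s s′ → inj P i i′ (S′⊆S i s) (S′⊆S i′ s′)
          ; good = λ j s s′ → good P j (S′⊆S _ s) (S′⊆S _ s′)
          }

        multidegree : Fin a → ℕ
        multidegree u = sumFin b (λ j → 𝟙 (e₁ j == u) + 𝟙 (e₂ j == u))

        multidegree-sum : sumFin a multidegree ≡ b * 2
        multidegree-sum = begin
          sumFin a multidegree
            ≡⟨ sumFin-swap a b _ ⟩
          sumFin b (λ j → sumFin a (λ u → 𝟙 (e₁ j == u) + 𝟙 (e₂ j == u)))
            ≡⟨ sumFin-cong b (λ j → trans (sumFin-+ a _ _)
                 (cong₂ _+_ (sum-==≡1 a (e₁ j)) (sum-==≡1 a (e₂ j)))) ⟩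
          sumFin b (λ j → 2)
            ≡⟨ sumFin-const b 2 ⟩
          b * 2 ∎
          where open ≡-Reasoning

        -- Greedy extension inside one sparse set.

        module _ {A : Fin N → Bool} {B : ℕ} (sp : Sparse A B) (T : Fin a → Bool)
          (smallT : 2 * countTrue a T < size A) where

          module _ {S : Fin a → Set} (S⊆T : ∀ i → S i → T i ≡ true) (P : Placement A S)
            (u : Fin a) (low : 2 * multidegree u ≤ B) where
            private
              used clash obstacles : Fin N → ℕ
              -- `S` comes without a decision procedure, so occupied vertices are counted over the
              -- Boolean superset `T`; junk values only add obstacles.
              used v = sumFin a (λ i → 𝟙 (T i) * 𝟙 (f P i == v))
              clash v = sumFin b (λ j → 𝟙 (e₁ j == u) * 𝟙 (bad (f P (e₂ j)) v)
                                      + 𝟙 (e₂ j == u) * 𝟙 (bad (f P (e₁ j)) v))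
              obstacles v = used v + clash v

              open ≤-Reasoning
              instance
                nzB : NonZero B
                nzB = >-nonZero (positive sp)

              used-sum : sumFin N (λ v → 𝟙 (A v) * used v) ≤ countTrue a T
              used-sum = begin
                sumFin N (λ v → 𝟙 (A v) * used v)
                  ≤⟨ sumFin-mono N (λ v → ≤-trans (*-monoˡ-≤ (used v) (𝟙≤1 (A v))) (≤-reflexive (*-identityˡ (used v)))) ⟩
                sumFin N used
                  ≡⟨ sumFin-swap N a _ ⟩
                sumFin a (λ i → sumFin N (λ v → 𝟙 (T i) * 𝟙 (f P i == v)))
                  ≡⟨ sumFin-cong a (λ i → trans (sumFin-*ˡ N (𝟙 (T i)) _)
                       (trans (cong (𝟙 (T i) *_) (sum-==≡1 N (f P i))) (*-identityʳ _))) ⟩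
                countTrue a T ∎

              clash-edge : ∀ x y i i′ →
                sumFin N (λ v → 𝟙 (A v) * (x * 𝟙 (bad (f P i) v) + y * 𝟙 (bad (f P i′) v)))
                  ≡ x * badDeg A (f P i) + y * badDeg A (f P i′)
              clash-edge x y i i′ = begin-equality
                sumFin N (λ v → 𝟙 (A v) * (x * 𝟙 (bad (f P i) v) + y * 𝟙 (bad (f P i′) v)))
                  ≡⟨ sumFin-cong N (λ v → trans (spread (𝟙 (A v)) x y _ _)
                       (cong₂ (λ s t → x * s + y * t) (sym (𝟙-∧ (A v) _)) (sym (𝟙-∧ (A v) _)))) ⟩
                sumFin N (λ v → x * 𝟙 (A v ∧ bad (f P i) v) + y * 𝟙 (A v ∧ bad (f P i′) v))
                  ≡⟨ sumFin-+ N _ _ ⟩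
                sumFin N (λ v → x * 𝟙 (A v ∧ bad (f P i) v)) + sumFin N (λ v → y * 𝟙 (A v ∧ bad (f P i′) v))
                  ≡⟨ cong₂ _+_ (sumFin-*ˡ N x _) (sumFin-*ˡ N y _) ⟩
                x * badDeg A (f P i) + y * badDeg A (f P i′) ∎
                where
                spread : ∀ c x y s t → c * (x * s + y * t) ≡ x * (c * s) + y * (c * t)
                spread = solve-∀

              -- Each edge at `u` rules out at most `size A / B` vertices, those bad with the image
              -- of its other end, and `u` has at most `B / 2` edges. So clashes rule out at most
              -- half of `A`.
              clash-sum : 2 * sumFin N (λ v → 𝟙 (A v) * clash v) ≤ size A
              clash-sum = *-cancelˡ-≤ B (begin
                B * (2 * sumFin N (λ v → 𝟙 (A v) * clash v))
                  ≡⟨ cong (λ s → B * (2 * s)) (trans (sumFin-cong N (λ v → sym (sumFin-*ˡ b (𝟙 (A v)) _)))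
                       (trans (sumFin-swap N b _)
                       (sumFin-cong b (λ j → clash-edge (𝟙 (e₁ j == u)) (𝟙 (e₂ j == u)) (e₂ j) (e₁ j))))) ⟩
                B * (2 * sumFin b perEdge)
                  ≡⟨ trans (exchange B 2 _) (cong (2 *_) (sym (sumFin-*ˡ b B perEdge))) ⟩
                2 * sumFin b (λ j → B * perEdge j)
                  ≤⟨ *-monoʳ-≤ 2 (sumFin-mono b perEdge-bound) ⟩
                2 * sumFin b (λ j → (𝟙 (e₁ j == u) + 𝟙 (e₂ j == u)) * size A)
                  ≡⟨ cong (2 *_) (sumFin-*ʳ b (size A) (λ j → 𝟙 (e₁ j == u) + 𝟙 (e₂ j == u))) ⟩
                2 * (multidegree u * size A)
                  ≡⟨ *-assoc 2 (multidegree u) (size A) ⟨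
                2 * multidegree u * size A
                  ≤⟨ *-monoˡ-≤ (size A) low ⟩
                B * size A ∎)
                where
                perEdge : Fin b → ℕ
                perEdge j = 𝟙 (e₁ j == u) * badDeg A (f P (e₂ j)) + 𝟙 (e₂ j == u) * badDeg A (f P (e₁ j))
                exchange : ∀ x y z → x * (y * z) ≡ y * (x * z)
                exchange = solve-∀
                distribute : ∀ B x y s t → B * (x * s + y * t) ≡ x * (B * s) + y * (B * t)
                distribute = solve-∀
                perEdge-bound : ∀ j → B * perEdge j ≤ (𝟙 (e₁ j == u) + 𝟙 (e₂ j == u)) * size A
                perEdge-bound j = begin
                  B * perEdge j
                    ≡⟨ distribute B (𝟙 (e₁ j == u)) (𝟙 (e₂ j == u)) _ _ ⟩
                  𝟙 (e₁ j == u) * (B * badDeg A (f P (e₂ j))) + 𝟙 (e₂ j == u) * (B * badDeg A (f P (e₁ j)))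
                    -- `into` also covers ends outside `S`, so an end not yet placed needs no
                    -- separate case.
                    ≤⟨ +-mono-≤ (*-monoʳ-≤ (𝟙 (e₁ j == u)) (badDegs sp _ (into P _)))
                                (*-monoʳ-≤ (𝟙 (e₂ j == u)) (badDegs sp _ (into P _))) ⟩
                  𝟙 (e₁ j == u) * size A + 𝟙 (e₂ j == u) * size A
                    ≡⟨ *-distribʳ-+ (size A) (𝟙 (e₁ j == u)) (𝟙 (e₂ j == u)) ⟨
                  (𝟙 (e₁ j == u) + 𝟙 (e₂ j == u)) * size A ∎

              -- Less than half of `A` is occupied, by `smallT`, and at most half clashes, so a free
              -- vertex remains.
              obstacles-sum : sumFin N (λ v → 𝟙 (A v) * obstacles v) < size A
              obstacles-sum = *-cancelˡ-< 2 _ _ (begin-strict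
                2 * sumFin N (λ v → 𝟙 (A v) * obstacles v)
                  ≡⟨ cong (2 *_) (trans (sumFin-cong N (λ v → *-distribˡ-+ (𝟙 (A v)) (used v) (clash v))) (sumFin-+ N _ _)) ⟩
                2 * (sumFin N (λ v → 𝟙 (A v) * used v) + sumFin N (λ v → 𝟙 (A v) * clash v))
                  ≡⟨ *-distribˡ-+ 2 (sumFin N (λ v → 𝟙 (A v) * used v)) _ ⟩
                2 * sumFin N (λ v → 𝟙 (A v) * used v) + 2 * sumFin N (λ v → 𝟙 (A v) * clash v)
                  ≤⟨ +-mono-≤ (*-monoʳ-≤ 2 used-sum) clash-sum ⟩
                2 * countTrue a T + size A
                  <⟨ +-monoˡ-< (size A) smallT ⟩
                size A + size A
                  ≡⟨ cong (size A +_) (+-identityʳ (size A)) ⟨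
                2 * size A ∎)

              free = countTrue-avoid N A obstacles obstacles-sum
              v = proj₁ free
              Av = proj₁ (proj₂ free)
              used≡0 : used v ≡ 0
              used≡0 = m+n≡0⇒m≡0 (used v) (proj₂ (proj₂ free))
              clash≡0 : clash v ≡ 0
              clash≡0 = m+n≡0⇒n≡0 (used v) (proj₂ (proj₂ free))

              unused : ∀ i → S i → f P i ≢ v
              unused i s = ==≡false⇒≢ (factor (T i) _ (S⊆T i s) (sumFin≡0⇒term≡0 a used≡0 i))
                where
                factor : ∀ x y → x ≡ true → 𝟙 x * 𝟙 y ≡ 0 → y ≡ false
                factor true false refl _ = refl

              -- The test `i == u` is generalised to `x` so that it can be split on; for `i ≡ u`
              -- only the true case survives, and there the badness indicator must vanish.
              clash-free : ∀ i {x} → (i == u) ≡ x → i ≡ u → ∀ y → 𝟙 x * 𝟙 y ≡ 0 → y ≡ false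
              clash-free i {true}  e i≡u false _ = refl
              clash-free i {false} e i≡u y     _ = ⊥-elim (==≡false⇒≢ e i≡u)

              good₁ : ∀ j → e₁ j ≡ u → bad v (f P (e₂ j)) ≡ false
              good₁ j e = trans (bad-sym v _) (clash-free (e₁ j) refl e _
                (m+n≡0⇒m≡0 _ (sumFin≡0⇒term≡0 b clash≡0 j)))

              good₂ : ∀ j → e₂ j ≡ u → bad (f P (e₁ j)) v ≡ false
              good₂ j e = clash-free (e₂ j) refl e _
                (m+n≡0⇒n≡0 (𝟙 (e₁ j == u) * 𝟙 (bad (f P (e₂ j)) v)) (sumFin≡0⇒term≡0 b clash≡0 j))

            extend : Placement A (λ i → S i ⊎ i ≡ u)
            extend = record { f = f⁺ ; into = into⁺ ; inj = inj⁺ ; good = good⁺ }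
              where
              f⁺ : Fin a → Fin N
              f⁺ i with i Fin.≟ u
              ... | yes _ = v
              ... | no  _ = f P i
              into⁺ : ∀ i → A (f⁺ i) ≡ true
              into⁺ i with i Fin.≟ u
              ... | yes _ = Av
              ... | no  _ = into P i
              old : ∀ {i} → i ≢ u → S i ⊎ i ≡ u → S i
              old i≢u (inj₁ s)   = s
              old i≢u (inj₂ i≡u) = ⊥-elim (i≢u i≡u)
              inj⁺ : ∀ i i′ → S i ⊎ i ≡ u → S i′ ⊎ i′ ≡ u → f⁺ i ≡ f⁺ i′ → i ≡ i′
              inj⁺ i i′ s s′ e with i Fin.≟ u | i′ Fin.≟ u
              ... | yes i≡u | yes i′≡u = trans i≡u (sym i′≡u)
              ... | yes _   | no  i′≢u = ⊥-elim (unused i′ (old i′≢u s′) (sym e))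
              ... | no  i≢u | yes _    = ⊥-elim (unused i (old i≢u s) e)
              ... | no  i≢u | no  i′≢u = inj P i i′ (old i≢u s) (old i′≢u s′) e
              good⁺ : ∀ j → S (e₁ j) ⊎ e₁ j ≡ u → S (e₂ j) ⊎ e₂ j ≡ u → bad (f⁺ (e₁ j)) (f⁺ (e₂ j)) ≡ false
              good⁺ j s s′ with e₁ j Fin.≟ u | e₂ j Fin.≟ u
              -- The multigraph has no loops.
              ... | yes p₁ | yes p₂ = ⊥-elim (e₁≢e₂ j (trans p₁ (sym p₂)))
              ... | yes p₁ | no  _  = good₁ j p₁
              ... | no  _  | yes p₂ = good₂ j p₂
              ... | no  p₁ | no  p₂ = good P j (old p₁ s) (old p₂ s′)

          -- Runs through all vertices and places those of `T` that `split` does not find in `S`;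
          -- these have degree low enough for `extend`. The index of the placement in `go` records
          -- which vertices have been treated.
          extendAll : ∀ {S : Fin a → Set} → (∀ i → S i → T i ≡ true) →
            (∀ i → T i ≡ true → S i ⊎ 2 * multidegree i ≤ B) →
            Placement A S → Placement A (λ i → T i ≡ true)
          extendAll {S} S⊆T split P = weaken (λ _ e → e) (λ i t → inj₂ (t , ∈-allFin i)) (go (allFin a))
            where
            go : (l : List (Fin a)) → Placement A (λ i → S i ⊎ (T i ≡ true × i ∈ l))
            go [] = weaken (λ _ e → e) (λ { i (inj₁ s) → s }) P
            go (u ∷ l) with T u in Tu
            ... | false = weaken (λ _ e → e)
                    (λ { i (inj₁ s) → inj₁ s
                       ; i (inj₂ (t , here refl)) → ⊥-elim (not-¬ t Tu)
                       ; i (inj₂ (t , there m)) → inj₂ (t , m) }) (go l)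
            ... | true with split u Tu
            ... | inj₁ su = weaken (λ _ e → e)
                    (λ { i (inj₁ s) → inj₁ s
                       ; i (inj₂ (t , here refl)) → inj₁ su
                       ; i (inj₂ (t , there m)) → inj₂ (t , m) }) (go l)
            ... | inj₂ low = weaken (λ _ e → e)
                    (λ { i (inj₁ s) → inj₁ (inj₁ s)
                       ; i (inj₂ (t , here refl)) → inj₂ refl
                       ; i (inj₂ (t , there m)) → inj₁ (inj₂ (t , m)) })
                    (extend (λ { i (inj₁ s) → S⊆T i s ; i (inj₂ (t , _)) → t }) (go l) u low)

        -- Levels of `U₁` by degree.

        -- The negation of the condition `low` under which `extend` places a vertex in a set of
        -- parameter `B`.
        degreeAbove : ℕ → Fin a → Bool
        degreeAbove B i = B <ᵇ 2 * multidegree i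

        degreeAbove-count : ∀ B → B * countTrue a (degreeAbove B) ≤ 4 * b
        degreeAbove-count B = begin
          B * countTrue a (degreeAbove B)               ≡⟨ sumFin-*ˡ a B _ ⟨
          sumFin a (λ i → B * 𝟙 (degreeAbove B i))      ≤⟨ sumFin-mono a markov ⟩
          sumFin a (λ i → 2 * multidegree i)            ≡⟨ sumFin-*ˡ a 2 _ ⟩
          2 * sumFin a multidegree                      ≡⟨ cong (2 *_) multidegree-sum ⟩
          2 * (b * 2)                                   ≡⟨ four b ⟩
          4 * b                                         ∎
          where
          open ≤-Reasoning
          four : ∀ b → 2 * (b * 2) ≡ 4 * b
          four = solve-∀
          markov : ∀ i → B * 𝟙 (degreeAbove B i) ≤ 2 * multidegree i
          markov i with B <ᵇ 2 * multidegree i in eq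
          ... | true  = ≤-trans (≤-reflexive (*-identityʳ B)) (<⇒≤ (<ᵇ≡true⇒< _ _ eq))
          ... | false = ≤-trans (≤-reflexive (*-zeroʳ B)) z≤n

        -- Shows that no vertex is above a level `B ≥ 4b`, which is where the recursion of
        -- `placeAbove` ends.
        2*multidegree≤4*b : ∀ i → 2 * multidegree i ≤ 4 * b
        2*multidegree≤4*b i = begin
          2 * multidegree i         ≤⟨ *-monoʳ-≤ 2 (term≤sumFin a multidegree i) ⟩
          2 * sumFin a multidegree  ≡⟨ cong (2 *_) multidegree-sum ⟩
          2 * (b * 2)               ≡⟨ four b ⟩
          4 * b                     ∎
          where
          open ≤-Reasoning
          four : ∀ b → 2 * (b * 2) ≡ 4 * b
          four = solve-∀

        b≤n : b ≤ n
        b≤n = subst (b ≤_) a+b≡n (m≤n+m b a)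

        -- In terms of ε, `16gn ≤ εN`: the bound with `ε²` is weakened by `ε ≤ 1`.
        16gr²n≤pN*r : 16 * g * r * n ≤ p * N
        16gr²n≤pN*r = *-cancelʳ-≤ _ _ r (begin
          16 * g * r * n * r    ≡⟨ pull g r n ⟩
          16 * g * (r * r) * n  ≤⟨ 16gr²n≤p²N ⟩
          p * p * N             ≡⟨ *-assoc p p N ⟩
          p * (p * N)           ≤⟨ *-monoˡ-≤ (p * N) p≤r ⟩
          r * (p * N)           ≡⟨ *-comm r (p * N) ⟩
          p * N * r             ∎)
          where
          open ≤-Reasoning
          pull : ∀ g r n → 16 * g * r * n * r ≡ 16 * g * (r * r) * n
          pull = solve-∀

        -- A vertex is placed at the first level g ^ s reaching twice its degree, so vertices placed at
        -- level g * B were too high for level B: there are at most 4b / B of them.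
        degreeAbove-fits : ∀ {A B} → 0 < B → Sparse A (g * B) → 2 * countTrue a (degreeAbove B) < size A
        degreeAbove-fits {A} {B} 0<B sp = *-cancelʳ-< (B * (g * r)) _ _ (begin-strict
          2 * countTrue a (degreeAbove B) * (B * (g * r))   ≡⟨ regroup (countTrue a (degreeAbove B)) B g r ⟩
          2 * g * r * (B * countTrue a (degreeAbove B))     ≤⟨ *-monoʳ-≤ (2 * g * r) (degreeAbove-count B) ⟩
          2 * g * r * (4 * b)                               ≤⟨ *-monoʳ-≤ (2 * g * r) (*-monoʳ-≤ 4 b≤n) ⟩
          2 * g * r * (4 * n)                               ≡⟨ eight g r n ⟩
          8 * (g * r * n)                                   <⟨ *-monoˡ-< (g * r * n) {{m*n≢0 (g * r) n {{m*n≢0 g r}}}} {8} {16} (m≤m+n 9 7) ⟩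
          16 * (g * r * n)                                  ≡⟨ sixteen g r n ⟩
          16 * g * r * n                                    ≤⟨ 16gr²n≤pN*r ⟩
          p * N                                             ≤⟨ large sp ⟩
          size A * (g * B) * r                              ≡⟨ reassoc (size A) g B r ⟩
          size A * (B * (g * r))                            ∎)
          where
          open ≤-Reasoning
          regroup : ∀ c B g r → 2 * c * (B * (g * r)) ≡ 2 * g * r * (B * c)
          regroup = solve-∀
          eight : ∀ g r n → 2 * g * r * (4 * n) ≡ 8 * (g * r * n)
          eight = solve-∀
          sixteen : ∀ g r n → 16 * (g * r * n) ≡ 16 * g * r * n
          sixteen = solve-∀
          reassoc : ∀ s g B r → s * (g * B) * r ≡ s * (B * (g * r))
          reassoc = solve-∀

        nowhere : ∀ {A B} → Sparse A B → Placement A (λ _ → ⊥)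
        nowhere {A} sp = record
          { f = λ _ → proj₁ some ; into = λ _ → proj₁ (proj₂ some)
          ; inj = λ _ _ () ; good = λ _ () }
          where
          -- With zero weights this just picks an element of the nonempty set `A`, to serve as the
          -- junk value everywhere.
          some = countTrue-avoid N A (λ _ → 0) (subst (_< size A)
            (sym (trans (sumFin-*ʳ N 0 (λ v → 𝟙 (A v))) (*-zeroʳ (size A)))) (sparse⇒nonempty sp))

        B<gB : ∀ {B} → 0 < B → B < g * B
        B<gB {B} 0<B = begin-strict
          B      ≡⟨ *-identityˡ B ⟨
          1 * B  <⟨ *-monoˡ-< B {{>-nonZero 0<B}} (≤-trans (m≤m+n 2 2) 4≤g) ⟩
          g * B  ∎
          where open ≤-Reasoning

        -- The recursion goes inwards first: vertices above `g * B` are placed in deeper sets, then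
        -- those between `B` and `g * B` in the refined set `A′`. As `B` grows strictly, one unit of
        -- fuel per level suffices to reach `4b`.
        placeAbove : ∀ fuel {A B} → Sparse A B → 4 * b ≤ B + fuel →
          Placement A (λ i → degreeAbove B i ≡ true)
        placeAbove zero {A} {B} sp enough = weaken (λ _ e → e) none (nowhere sp)
          where
          none : ∀ i → degreeAbove B i ≡ true → ⊥
          none i e = <⇒≱ (<ᵇ≡true⇒< B _ e)
            (≤-trans (2*multidegree≤4*b i) (subst (4 * b ≤_) (+-identityʳ B) enough))
        placeAbove (suc fuel) {A} {B} sp enough =
          weaken A′⊆A (λ _ e → e) (extendAll sp′ (degreeAbove B) (degreeAbove-fits (positive sp) sp′)
            (λ i e → <⇒<ᵇ≡true (<-trans (B<gB (positive sp)) (<ᵇ≡true⇒< (g * B) (2 * multidegree i) e))) split (placeAbove fuel sp′ enough′))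
          where
          refined = refine sp
          A′⊆A = proj₁ (proj₂ refined)
          sp′ = proj₂ (proj₂ refined)
          enough′ : 4 * b ≤ g * B + fuel
          enough′ = ≤-trans enough (≤-trans (≤-reflexive (+-suc B fuel)) (+-monoˡ-≤ fuel (B<gB (positive sp))))
          split : ∀ i → degreeAbove B i ≡ true → degreeAbove (g * B) i ≡ true ⊎ 2 * multidegree i ≤ g * B
          split i _ with g * B <ᵇ 2 * multidegree i in eq
          ... | true  = inj₁ refl
          ... | false = inj₂ (<ᵇ≡false⇒≥ (g * B) _ eq)

        -- What is left has `2 * multidegree i ≤ 1`, so it is isolated and only has to avoid
        -- occupied vertices; the outermost set has room for it.
        placeAll : Placement highDegree (λ _ → true ≡ true)
        placeAll = extendAll highDegree-sparse (λ _ → true) fits (λ _ _ → refl) split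
                     (placeAbove (4 * b) highDegree-sparse (m≤n+m (4 * b) 1))
          where
          open ≤-Reasoning
          fits : 2 * countTrue a (λ _ → true) < size highDegree
          fits = *-cancelʳ-< r _ _ (begin-strict
            2 * countTrue a (λ _ → true) * r   ≤⟨ *-monoˡ-≤ r (*-monoʳ-≤ 2 (countTrue≤k a (λ _ → true))) ⟩
            2 * a * r                          ≤⟨ *-monoˡ-≤ r (*-monoʳ-≤ 2 (subst (a ≤_) a+b≡n (m≤m+n a b))) ⟩
            2 * n * r                          ≡⟨ *-assoc 2 n r ⟩
            2 * (n * r)                        <⟨ *-monoˡ-< (n * r) {{m*n≢0 n r}} {2} {16 * g} (≤-trans (m≤m+n 3 13) (m≤m*n 16 g)) ⟩
            16 * g * (n * r)                   ≡⟨ reorder g n r ⟩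
            16 * g * r * n                     ≤⟨ 16gr²n≤pN*r ⟩
            p * N                              ≤⟨ manyHighDegree ⟩
            size highDegree * r                ∎)
            where
            reorder : ∀ g n r → 16 * g * (n * r) ≡ 16 * g * r * n
            reorder = solve-∀
          split : ∀ i → true ≡ true → degreeAbove 1 i ≡ true ⊎ 2 * multidegree i ≤ 1
          split i _ with 1 <ᵇ 2 * multidegree i in eq
          ... | true  = inj₁ refl
          ... | false = inj₂ (<ᵇ≡false⇒≥ 1 _ eq)

        -- Embedding both parts.

        -- The ends of every edge are not bad, so they have at least `n = a + b` common neighbours,
        -- enough for distinct representatives that also avoid the image of `U₁`.
        embedSubdivision : Σ (Fin a → Fin N) λ f → Σ (Fin b → Fin N) λ h →
          (∀ i i′ → f i ≡ f i′ → i ≡ i′) × (∀ j j′ → h j ≡ h j′ → j ≡ j′) × (∀ i j → f i ≢ h j) ×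
          (∀ j → adj G (f (e₁ j)) (h j) ≡ true × adj G (f (e₂ j)) (h j) ≡ true)
        embedSubdivision = F , proj₁ reps , (λ i i′ → inj placeAll i i′ refl refl) , proj₂ (proj₂ (proj₂ reps)) ,
          proj₁ (proj₂ (proj₂ reps)) ,
          (λ j → ∧-trueˡ (proj₁ (proj₂ reps) j) , ∧-trueʳ {adj G (F (e₁ j)) _} (proj₁ (proj₂ reps) j))
          where
          F = f placeAll
          reps = distinctRepresentatives N a b F (λ j x → adj G (F (e₁ j)) x ∧ adj G (F (e₂ j)) x)
            (λ j → subst (_≤ codeg (F (e₁ j)) (F (e₂ j))) (sym a+b≡n)
                     (<ᵇ≡false⇒≥ _ n (good placeAll j refl refl)))

  containsBip : ∀ {N} (G : Graph N) n p r → 0 < p → 0 < r → 0 < n →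
    128 * n * (r * r * r) ≤ p * p * p * N → p * (N * N) ≤ edgeCount G * r →
    ∀ {a b} → a + b ≡ n → (F : BipGraph a b) → (∀ j → degree₂ F j ≡ 2) → ContainsBip G F
  containsBip {N} G n p r 0<p 0<r 0<n vertices edges {a} {b} a+b≡n F deg₂ = assemble embedSubdivision
    where
    ends : ∀ j → Σ (Fin a) λ x → Σ (Fin a) λ y → x ≢ y × (∀ i → F i j ≡ true → i ≡ x ⊎ i ≡ y)
    ends j = countTrue≡2⇒two a (λ i → F i j) (deg₂ j)
    e₁ e₂ : Fin b → Fin a
    e₁ j = proj₁ (ends j)
    e₂ j = proj₁ (proj₂ (ends j))
    open DependentRandomChoice G n
    open Density p r 0<p 0<r 0<n vertices edges
    open Multigraph e₁ e₂ (λ j → proj₁ (proj₂ (proj₂ (ends j)))) a+b≡n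
    assemble : (Σ (Fin a → Fin N) λ f → Σ (Fin b → Fin N) λ h →
        (∀ i i′ → f i ≡ f i′ → i ≡ i′) × (∀ j j′ → h j ≡ h j′ → j ≡ j′) × (∀ i j → f i ≢ h j) ×
        (∀ j → adj G (f (e₁ j)) (h j) ≡ true × adj G (f (e₂ j)) (h j) ≡ true)) →
      ContainsBip G F
    assemble (f , h , f-inj , h-inj , f≢h , adjacent) = φ , (λ {x} {y} → φ-inj x y) , φ-adj
      where
      φ : Fin a ⊎ Fin b → Fin N
      φ = [ f , h ]′
      φ-inj : ∀ x y → φ x ≡ φ y → x ≡ y
      φ-inj (inj₁ i) (inj₁ i′) e = cong inj₁ (f-inj i i′ e)
      φ-inj (inj₁ i) (inj₂ j)  e = ⊥-elim (f≢h i j e)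
      φ-inj (inj₂ j) (inj₁ i)  e = ⊥-elim (f≢h i j (sym e))
      φ-inj (inj₂ j) (inj₂ j′) e = cong inj₂ (h-inj j j′ e)
      φ-adj : ∀ i j → F i j ≡ true → adj G (f i) (h j) ≡ true
      φ-adj i j e = [ (λ { refl → proj₁ (adjacent j) }) , (λ { refl → proj₂ (adjacent j) }) ]′
                      (proj₂ (proj₂ (proj₂ (ends j))) i e)

-- From rational to natural inequalities.

module ClearDenominators where

  open import Defs using (ℕ→ℚ)
  open import Data.Nat using (ℕ; suc; z≤n; s≤s)
  import Data.Nat as ℕ
  import Data.Nat.Properties as ℕ
  open import Data.Integer as ℤ using (+_; -[1+_]; +<+)
  import Data.Integer.Properties as ℤ
  open import Data.Rational as ℚ using (mkℚ; 0ℚ; toℚᵘ; *<*)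
  import Data.Rational.Properties as ℚ
  open import Data.Rational.Unnormalised as ℚᵘ using (mkℚᵘ; _≃_; ↥_; ↧_)
  import Data.Rational.Unnormalised.Properties as ℚᵘ
  open import Data.Product using (Σ; _×_; _,_)
  open import Relation.Binary.PropositionalEquality

  -- `ℕ→ℚ n` is normalised by a gcd that does not compute for a variable `n`, so it is compared with
  -- `n / 1` only up to `≃`.
  ℕ→ℚ-≃ : ∀ n → toℚᵘ (ℕ→ℚ n) ≃ mkℚᵘ (+ n) 0
  ℕ→ℚ-≃ n = ℚ.toℚᵘ-fromℚᵘ (mkℚᵘ (+ n) 0)

  *-≃ : ∀ x y {x′ y′} → toℚᵘ x ≃ x′ → toℚᵘ y ≃ y′ → toℚᵘ (x ℚ.* y) ≃ x′ ℚᵘ.* y′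
  *-≃ x y x≃ y≃ = ℚᵘ.≃-trans (ℚ.toℚᵘ-homo-* x y) (ℚᵘ.*-cong x≃ y≃)

  -- Passing to unnormalised representatives makes numerators and denominators plain products, free
  -- of gcds.
  crossMultiply : ∀ {x y x′ y′} → toℚᵘ x ≃ x′ → toℚᵘ y ≃ y′ → x ℚ.≤ y →
    ↥ x′ ℤ.* ↧ y′ ℤ.≤ ↥ y′ ℤ.* ↧ x′
  crossMultiply x≃ y≃ x≤y =
    ℚᵘ.drop-*≤* (ℚᵘ.≤-respˡ-≃ x≃ (ℚᵘ.≤-respʳ-≃ y≃ (ℚ.toℚᵘ-mono-≤ x≤y)))

  *-pos : ∀ {x y a b} → x ≡ + a → y ≡ + b → x ℤ.* y ≡ + (a ℕ.* b)
  *-pos {a = a} {b} refl refl = sym (ℤ.pos-* a b)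

  clearDenominators : ∀ ε → 0ℚ ℚ.< ε → Σ ℕ λ p → Σ ℕ λ r → 0 ℕ.< p × 0 ℕ.< r ×
    (∀ n N → ℕ→ℚ 128 ℚ.* ℕ→ℚ n ℚ.≤ ε ℚ.* ε ℚ.* ε ℚ.* ℕ→ℚ N →
       128 ℕ.* n ℕ.* (r ℕ.* r ℕ.* r) ℕ.≤ p ℕ.* p ℕ.* p ℕ.* N) ×
    (∀ N E → ε ℚ.* (ℕ→ℚ N ℚ.* ℕ→ℚ N) ℚ.≤ ℕ→ℚ E → p ℕ.* (N ℕ.* N) ℕ.≤ E ℕ.* r)
  clearDenominators (mkℚ (+ 0) r-1 c) (*<* (+<+ ()))
  clearDenominators (mkℚ -[1+ _ ] r-1 c) (*<* ())
  clearDenominators ε@(mkℚ (+ suc p-1) r-1 c) 0<ε = p , r , s≤s z≤n , s≤s z≤n , vertices , edges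
    where
    p = suc p-1
    r = suc r-1
    e = mkℚᵘ (+ p) r-1
    ε≃e : toℚᵘ ε ≃ e
    ε≃e = ℚᵘ.≃-refl
    vertices : ∀ n N → ℕ→ℚ 128 ℚ.* ℕ→ℚ n ℚ.≤ ε ℚ.* ε ℚ.* ε ℚ.* ℕ→ℚ N →
      128 ℕ.* n ℕ.* (r ℕ.* r ℕ.* r) ℕ.≤ p ℕ.* p ℕ.* p ℕ.* N
    -- The denominator of `ε * ε * ε * ℕ→ℚ N` is represented as `r * r * r * 1`, that of `128 * n`
    -- as 1; the identity laws remove the ones.
    vertices n N le = subst₂ ℕ._≤_ (cong (128 ℕ.* n ℕ.*_) (ℕ.*-identityʳ (r ℕ.* r ℕ.* r))) (ℕ.*-identityʳ _)
      (ℤ.drop‿+≤+ (subst₂ ℤ._≤_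
        (*-pos {b = r ℕ.* r ℕ.* r ℕ.* 1} (*-pos {a = 128} {n} refl refl) refl)
        (*-pos {b = 1} (*-pos {b = N} (*-pos {b = p} (*-pos {a = p} {p} refl refl) refl) refl) refl)
        (crossMultiply
          (*-≃ (ℕ→ℚ 128) (ℕ→ℚ n) (ℕ→ℚ-≃ 128) (ℕ→ℚ-≃ n))
          (*-≃ (ε ℚ.* ε ℚ.* ε) (ℕ→ℚ N) (*-≃ (ε ℚ.* ε) ε (*-≃ ε ε ε≃e ε≃e) ε≃e) (ℕ→ℚ-≃ N))
          le)))
    edges : ∀ N E → ε ℚ.* (ℕ→ℚ N ℚ.* ℕ→ℚ N) ℚ.≤ ℕ→ℚ E → p ℕ.* (N ℕ.* N) ℕ.≤ E ℕ.* r
    edges N E le = subst₂ ℕ._≤_ (ℕ.*-identityʳ _) (cong (E ℕ.*_) (ℕ.*-identityʳ r))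
      (ℤ.drop‿+≤+ (subst₂ ℤ._≤_
        (*-pos {b = 1} (*-pos {a = p} refl (*-pos {a = N} {N} refl refl)) refl)
        (*-pos {a = E} {r ℕ.* 1} refl refl)
        (crossMultiply
          (*-≃ ε (ℕ→ℚ N ℚ.* ℕ→ℚ N) ε≃e (*-≃ (ℕ→ℚ N) (ℕ→ℚ N) (ℕ→ℚ-≃ N) (ℕ→ℚ-≃ N)))
          (ℕ→ℚ-≃ E)
          le)))

open import Defs
open import Data.Nat using (ℕ; _+_; _≥_)
open import Data.Rational using (ℚ; 0ℚ; _<_; _≤_; _*_)
open import Data.Fin using (Fin)
open import Data.Product using (_,_)
open import Relation.Binary.PropositionalEquality using (_≡_)

theorem8p5 : (ε : ℚ) → 0ℚ < ε → (n : ℕ) → n ≥ 1 →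
    (N : ℕ) → ℕ→ℚ 128 * ℕ→ℚ n ≤ ε * ε * ε * ℕ→ℚ N →
    (G : Graph N) → ε * (ℕ→ℚ N * ℕ→ℚ N) ≤ ℕ→ℚ (edgeCount G) →
    (a b : ℕ) → a + b ≡ n → (F : BipGraph a b) →
    (∀ j → degree₂ F j ≡ 2) →
    ContainsBip G F
theorem8p5 ε 0<ε n n≥1 N vertices G edges a b a+b≡n F deg₂ =
  let p , r , 0<p , 0<r , clearVertices , clearEdges = ClearDenominators.clearDenominators ε 0<ε
  in Embedding.containsBip G n p r 0<p 0<r n≥1
       (clearVertices n N vertices) (clearEdges N (edgeCount G) edges) a+b≡n F deg₂
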